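{- Let $\mathcal{F}$ be the folded component (with vertex set $\{0,1,\dots,\mathrm{ord}(\ell)-1\}$ and edges as specified in the context), and let $d$ be its graph distance. Let $v,w\in V(\mathcal{F})\setminus\{0\}$. Then $$d(v,w)=\begin{cases}\frac12|v-w| & \text{if } 2\nmid v \text{ and } 2\nmid w,\ \text{or } v=w,\\ \frac12|v-w-1|+1 & \text{if } 2\mid v\text{ and }2\nmid w,\\ \frac12|v-w|+2 & \text{if } 2\mid v,\ 2\mid w\text{ and } v\neq w.\end{cases}$$ (The remaining case, $v$ odd and $w$ even, is covered by the symmetry $d(v,w)=d(w,v)$.)
   Context: Let $p$ be a prime with $p\equiv 71$ or $119\pmod{120}$, let $\ell=2$, and let $\mathrm{ord}(\ell)$ be the order, in the ideal class group of $\mathbb{Q}(\sqrt{ -p})$, of a prime ideal above $2$; it is an odd integer $\ge 3$. The folded component $\mathcal{F}$ (a component of the supersingular $2$-isogeny graph over $\mathbb{F}_p$ after identifying curves up to $\overline{\mathbb{F}_p}$-isomorphism, regarded as a simple undirected graph) is labelled so that $V(\mathcal{F})=\{0,1,\dots,\mathrm{ord}(\ell)-1\}$ and $$E(\mathcal{F})=\{\{2k-1,2k+1\}: 1\le k\le \tfrac12(\mathrm{ord}(\ell)-3)\}\cup\{\{2k+1,2k+2\}:0\le k\le \tfrac12(\mathrm{ord}(\ell)-3)\}\cup\{\{0,1\}\}.$$ The distance $d(v,w)$ is the minimum number of edges of a path from $v$ to $w$. -}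

module Defs where

open import Algebra.Bundles using (CommutativeRing)
open import Data.Fin.Base using (Fin; toℕ)
open import Data.Integer.Base as ℤ using (ℤ; +_)
open import Data.Integer.Tactic.RingSolver using (solve-∀)
open import Data.List.Base using (List; []; _∷_)
open import Data.List.Relation.Unary.Unique.Propositional using (Unique)
open import Data.Nat.Base using (ℕ; zero; suc; _+_; _*_; _∸_; _/_; _≤_; _<_)
open import Data.Product.Base using (_×_; _,_; Σ-syntax; ∃-syntax)
open import Data.Sum.Base using (_⊎_)
open import Data.Unit.Base using (⊤; tt)
open import Level using (0ℓ)
open import Relation.Binary.Core using (Rel)
open import Relation.Binary.Construct.Closure.ReflexiveTransitive using (Star; ε; _◅_)
open import Relation.Binary.Construct.Closure.Symmetric using (SymClosure)
open import Relation.Binary.PropositionalEquality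
  using (_≡_; cong₂; isEquivalence)
open import Relation.Nullary.Negation.Core using (¬_)
open import Relation.Unary using (Pred; _≐_)

module _ (R : CommutativeRing 0ℓ 0ℓ) where

  private module R = CommutativeRing R

  record Ideal : Set₁ where
    field
      Member   : Pred R.Carrier 0ℓ
      resp-≈   : ∀ {x y} → x R.≈ y → Member x → Member y
      0#-mem   : Member R.0#
      +-closed : ∀ {x y} → Member x → Member y → Member (x R.+ y)
      *-absorb : ∀ r {x} → Member x → Member (r R.* x)

module _ {R : CommutativeRing 0ℓ 0ℓ} where

  private module R = CommutativeRing R

  infix 4 _∈ᴵ_
  _∈ᴵ_ : R.Carrier → Ideal R → Set
  x ∈ᴵ I = Ideal.Member I x

  record IsPrimeIdeal (I : Ideal R) : Set where
    field
      proper : ¬ (R.1# ∈ᴵ I)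
      prime  : ∀ x y → x R.* y ∈ᴵ I → x ∈ᴵ I ⊎ y ∈ᴵ I

  unitIdeal : Ideal R
  unitIdeal = record
    { Member   = λ _ → ⊤
    ; resp-≈   = λ _ _ → tt
    ; 0#-mem   = tt
    ; +-closed = λ _ _ → tt
    ; *-absorb = λ _ _ → tt
    }

  -- Membership in IJ: finite sums of products xy with x ∈ I and y ∈ J.
  data ProductMember (I J : Ideal R) : Pred R.Carrier 0ℓ where
    none : ∀ {z} → z R.≈ R.0# → ProductMember I J z
    term : ∀ {x y s z} → x ∈ᴵ I → y ∈ᴵ J → ProductMember I J s →
           z R.≈ x R.* y R.+ s → ProductMember I J z

  infixl 7 _·_
  _·_ : Ideal R → Ideal R → Ideal R
  I · J = record
    { Member   = ProductMember I J
    ; resp-≈   = resp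
    ; 0#-mem   = none R.refl
    ; +-closed = add
    ; *-absorb = absorb
    }
    where
    resp : ∀ {x y} → x R.≈ y → ProductMember I J x → ProductMember I J y
    resp e (none z≈0)     = none (R.trans (R.sym e) z≈0)
    resp e (term i j s q) = term i j s (R.trans (R.sym e) q)

    add : ∀ {x y} → ProductMember I J x → ProductMember I J y →
          ProductMember I J (x R.+ y)
    add (none z≈0) m =
      resp (R.sym (R.trans (R.+-congʳ z≈0) (R.+-identityˡ _))) m
    add (term i j s q) m =
      term i j (add s m) (R.trans (R.+-congʳ q) (R.+-assoc _ _ _))

    absorb : ∀ r {x} → ProductMember I J x → ProductMember I J (r R.* x)
    absorb r (none z≈0) = none (R.trans (R.*-congˡ z≈0) (R.zeroʳ r))
    absorb r (term i j s q) =
      term (Ideal.*-absorb I r i) j (absorb r s)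
        (R.trans (R.*-congˡ q)
          (R.trans (R.distribˡ r _ _) (R.+-congʳ (R.sym (R.*-assoc r _ _)))))

  infixr 8 _^ᴵ_
  _^ᴵ_ : Ideal R → ℕ → Ideal R
  I ^ᴵ zero  = unitIdeal
  I ^ᴵ suc n = I · I ^ᴵ n

  infixr 7 _⊛_
  _⊛_ : R.Carrier → Ideal R → Pred R.Carrier 0ℓ
  (α ⊛ I) z = ∃[ x ] (x ∈ᴵ I × z R.≈ α R.* x)

  -- Equality of ideal classes without fractional ideals: αI = βJ for some
  -- nonzero α and β.
  infix 4 _∼_
  _∼_ : Rel (Ideal R) 0ℓ
  I ∼ J = ∃[ α ] ∃[ β ] (¬ (α R.≈ R.0#) × ¬ (β R.≈ R.0#) × α ⊛ I ≐ β ⊛ J)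

  record HasClassOrder (I : Ideal R) (n : ℕ) : Set where
    field
      positive : 0 < n
      trivial  : I ^ᴵ n ∼ unitIdeal
      minimal  : ∀ m → 0 < m → I ^ᴵ m ∼ unitIdeal → n ≤ m

-- ℤ[ω] with ω² = ω − m; the pair (a , b) stands for a + bω.
module _ (m : ℤ) where

  private
    infixl 6 _⊕_
    infixl 7 _⊗_

    _⊕_ _⊗_ : ℤ × ℤ → ℤ × ℤ → ℤ × ℤ
    (a , b) ⊕ (c , d) = a ℤ.+ c , b ℤ.+ d
    (a , b) ⊗ (c , d) =
      a ℤ.* c ℤ.- m ℤ.* (b ℤ.* d) , a ℤ.* d ℤ.+ b ℤ.* c ℤ.+ b ℤ.* d

    ⊝_ : ℤ × ℤ → ℤ × ℤ
    ⊝ (a , b) = ℤ.- a , ℤ.- b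

    𝟘 𝟙 : ℤ × ℤ
    𝟘 = + 0 , + 0
    𝟙 = + 1 , + 0

    ⊕-assoc : ∀ x y z → (x ⊕ y) ⊕ z ≡ x ⊕ (y ⊕ z)
    ⊕-assoc (a , b) (c , d) (e , f) = cong₂ _,_ (l a c e) (l b d f)
      where
      l : ∀ a c e → (a ℤ.+ c) ℤ.+ e ≡ a ℤ.+ (c ℤ.+ e)
      l = solve-∀

    ⊕-comm : ∀ x y → x ⊕ y ≡ y ⊕ x
    ⊕-comm (a , b) (c , d) = cong₂ _,_ (l a c) (l b d)
      where
      l : ∀ a c → a ℤ.+ c ≡ c ℤ.+ a
      l = solve-∀

    ⊕-identityˡ : ∀ x → 𝟘 ⊕ x ≡ x
    ⊕-identityˡ (a , b) = cong₂ _,_ (l a) (l b)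
      where
      l : ∀ a → + 0 ℤ.+ a ≡ a
      l = solve-∀

    ⊕-identityʳ : ∀ x → x ⊕ 𝟘 ≡ x
    ⊕-identityʳ (a , b) = cong₂ _,_ (l a) (l b)
      where
      l : ∀ a → a ℤ.+ + 0 ≡ a
      l = solve-∀

    ⊕-inverseˡ : ∀ x → (⊝ x) ⊕ x ≡ 𝟘
    ⊕-inverseˡ (a , b) = cong₂ _,_ (l a) (l b)
      where
      l : ∀ a → ℤ.- a ℤ.+ a ≡ + 0
      l = solve-∀

    ⊕-inverseʳ : ∀ x → x ⊕ (⊝ x) ≡ 𝟘
    ⊕-inverseʳ (a , b) = cong₂ _,_ (l a) (l b)
      where
      l : ∀ a → a ℤ.+ ℤ.- a ≡ + 0
      l = solve-∀

    ⊗-assoc : ∀ x y z → (x ⊗ y) ⊗ z ≡ x ⊗ (y ⊗ z)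
    ⊗-assoc (a , b) (c , d) (e , f) =
      cong₂ _,_ (l₁ m a b c d e f) (l₂ m a b c d e f)
      where
      l₁ : ∀ m a b c d e f →
           (a ℤ.* c ℤ.- m ℤ.* (b ℤ.* d)) ℤ.* e
             ℤ.- m ℤ.* ((a ℤ.* d ℤ.+ b ℤ.* c ℤ.+ b ℤ.* d) ℤ.* f)
           ≡ a ℤ.* (c ℤ.* e ℤ.- m ℤ.* (d ℤ.* f))
             ℤ.- m ℤ.* (b ℤ.* (c ℤ.* f ℤ.+ d ℤ.* e ℤ.+ d ℤ.* f))
      l₁ = solve-∀
      l₂ : ∀ m a b c d e f →
           (a ℤ.* c ℤ.- m ℤ.* (b ℤ.* d)) ℤ.* f
             ℤ.+ (a ℤ.* d ℤ.+ b ℤ.* c ℤ.+ b ℤ.* d) ℤ.* e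
             ℤ.+ (a ℤ.* d ℤ.+ b ℤ.* c ℤ.+ b ℤ.* d) ℤ.* f
           ≡ a ℤ.* (c ℤ.* f ℤ.+ d ℤ.* e ℤ.+ d ℤ.* f)
             ℤ.+ b ℤ.* (c ℤ.* e ℤ.- m ℤ.* (d ℤ.* f))
             ℤ.+ b ℤ.* (c ℤ.* f ℤ.+ d ℤ.* e ℤ.+ d ℤ.* f)
      l₂ = solve-∀

    ⊗-comm : ∀ x y → x ⊗ y ≡ y ⊗ x
    ⊗-comm (a , b) (c , d) = cong₂ _,_ (l₁ m a b c d) (l₂ a b c d)
      where
      l₁ : ∀ m a b c d → a ℤ.* c ℤ.- m ℤ.* (b ℤ.* d) ≡ c ℤ.* a ℤ.- m ℤ.* (d ℤ.* b)
      l₁ = solve-∀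
      l₂ : ∀ a b c d → a ℤ.* d ℤ.+ b ℤ.* c ℤ.+ b ℤ.* d
                     ≡ c ℤ.* b ℤ.+ d ℤ.* a ℤ.+ d ℤ.* b
      l₂ = solve-∀

    ⊗-identityˡ : ∀ x → 𝟙 ⊗ x ≡ x
    ⊗-identityˡ (a , b) = cong₂ _,_ (l₁ m a b) (l₂ a b)
      where
      l₁ : ∀ m a b → + 1 ℤ.* a ℤ.- m ℤ.* (+ 0 ℤ.* b) ≡ a
      l₁ = solve-∀
      l₂ : ∀ a b → + 1 ℤ.* b ℤ.+ + 0 ℤ.* a ℤ.+ + 0 ℤ.* b ≡ b
      l₂ = solve-∀

    ⊗-identityʳ : ∀ x → x ⊗ 𝟙 ≡ x
    ⊗-identityʳ (a , b) = cong₂ _,_ (l₁ m a b) (l₂ a b)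
      where
      l₁ : ∀ m a b → a ℤ.* + 1 ℤ.- m ℤ.* (b ℤ.* + 0) ≡ a
      l₁ = solve-∀
      l₂ : ∀ a b → a ℤ.* + 0 ℤ.+ b ℤ.* + 1 ℤ.+ b ℤ.* + 0 ≡ b
      l₂ = solve-∀

    ⊗-distribˡ : ∀ x y z → x ⊗ (y ⊕ z) ≡ (x ⊗ y) ⊕ (x ⊗ z)
    ⊗-distribˡ (a , b) (c , d) (e , f) =
      cong₂ _,_ (l₁ m a b c d e f) (l₂ a b c d e f)
      where
      l₁ : ∀ m a b c d e f →
           a ℤ.* (c ℤ.+ e) ℤ.- m ℤ.* (b ℤ.* (d ℤ.+ f))
           ≡ (a ℤ.* c ℤ.- m ℤ.* (b ℤ.* d)) ℤ.+ (a ℤ.* e ℤ.- m ℤ.* (b ℤ.* f))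
      l₁ = solve-∀
      l₂ : ∀ a b c d e f →
           a ℤ.* (d ℤ.+ f) ℤ.+ b ℤ.* (c ℤ.+ e) ℤ.+ b ℤ.* (d ℤ.+ f)
           ≡ (a ℤ.* d ℤ.+ b ℤ.* c ℤ.+ b ℤ.* d)
             ℤ.+ (a ℤ.* f ℤ.+ b ℤ.* e ℤ.+ b ℤ.* f)
      l₂ = solve-∀

    ⊗-distribʳ : ∀ x y z → (y ⊕ z) ⊗ x ≡ (y ⊗ x) ⊕ (z ⊗ x)
    ⊗-distribʳ (a , b) (c , d) (e , f) =
      cong₂ _,_ (l₁ m a b c d e f) (l₂ a b c d e f)
      where
      l₁ : ∀ m a b c d e f →
           (c ℤ.+ e) ℤ.* a ℤ.- m ℤ.* ((d ℤ.+ f) ℤ.* b)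
           ≡ (c ℤ.* a ℤ.- m ℤ.* (d ℤ.* b)) ℤ.+ (e ℤ.* a ℤ.- m ℤ.* (f ℤ.* b))
      l₁ = solve-∀
      l₂ : ∀ a b c d e f →
           (c ℤ.+ e) ℤ.* b ℤ.+ (d ℤ.+ f) ℤ.* a ℤ.+ (d ℤ.+ f) ℤ.* b
           ≡ (c ℤ.* b ℤ.+ d ℤ.* a ℤ.+ d ℤ.* b)
             ℤ.+ (e ℤ.* b ℤ.+ f ℤ.* a ℤ.+ f ℤ.* b)
      l₂ = solve-∀

  quadraticRing : CommutativeRing 0ℓ 0ℓ
  quadraticRing = record
    { Carrier = ℤ × ℤ
    ; _≈_ = _≡_
    ; _+_ = _⊕_
    ; _*_ = _⊗_
    ; -_ = ⊝_
    ; 0# = 𝟘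
    ; 1# = 𝟙
    ; isCommutativeRing = record
      { isRing = record
        { +-isAbelianGroup = record
          { isGroup = record
            { isMonoid = record
              { isSemigroup = record
                { isMagma = record
                  { isEquivalence = isEquivalence
                  ; ∙-cong = cong₂ _⊕_
                  }
                ; assoc = ⊕-assoc
                }
              ; identity = ⊕-identityˡ , ⊕-identityʳ
              }
            ; inverse = ⊕-inverseˡ , ⊕-inverseʳ
            ; ⁻¹-cong = λ { _≡_.refl → _≡_.refl }
            }
          ; comm = ⊕-comm
          }
        ; *-cong = cong₂ _⊗_
        ; *-assoc = ⊗-assoc
        ; *-identity = ⊗-identityˡ , ⊗-identityʳ
        ; distrib = ⊗-distribˡ , ⊗-distribʳ
        }
      ; *-comm = ⊗-comm
      }
    }

-- The ring of integers of ℚ(√-p) for squarefree p ≡ 3 (mod 4): then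
-- ω = (1 + √-p)/2 satisfies ω² = ω − (p + 1)/4, the division being exact.
𝓞 : ℕ → CommutativeRing 0ℓ 0ℓ
𝓞 p = quadraticRing (+ ((p + 1) / 4))

record IsPrimeAbove (ℓ p : ℕ) (𝔭 : Ideal (𝓞 p)) : Set where
  field
    isPrimeIdeal : IsPrimeIdeal 𝔭
    contains     : (+ ℓ , + 0) ∈ᴵ 𝔭

module _ {V : Set} {_~_ : Rel V 0ℓ} where

  vertices : ∀ {v w} → Star _~_ v w → List V
  vertices {v} ε       = v ∷ []
  vertices {v} (_ ◅ p) = v ∷ vertices p

  edgeCount : ∀ {v w} → Star _~_ v w → ℕ
  edgeCount ε       = 0
  edgeCount (_ ◅ p) = suc (edgeCount p)

Path : {V : Set} → Rel V 0ℓ → V → V → Set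
Path _~_ v w = Σ[ p ∈ Star _~_ v w ] Unique (vertices p)

length : {V : Set} {_~_ : Rel V 0ℓ} {v w : V} → Path _~_ v w → ℕ
length (p , _) = edgeCount p

record IsDistance {V : Set} (_~_ : Rel V 0ℓ) (v w : V) (d : ℕ) : Set where
  field
    attained : ∃[ p ] length {_~_ = _~_} {v} {w} p ≡ d
    minimal  : ∀ (p : Path _~_ v w) → d ≤ length p

-- Each edge is listed in one direction; n is the order of the ideal class.  The
-- subtractions and divisions are exact for the odd n ≥ 3 that occur.
data FoldedEdge (n : ℕ) (v w : Fin n) : Set where
  spine : ∀ k → 1 ≤ k → k ≤ (n ∸ 3) / 2 →
          toℕ v ≡ 2 * k ∸ 1 → toℕ w ≡ 2 * k + 1 → FoldedEdge n v w
  leaf  : ∀ k → k ≤ (n ∸ 3) / 2 →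
          toℕ v ≡ 2 * k + 1 → toℕ w ≡ 2 * k + 2 → FoldedEdge n v w
  base  : toℕ v ≡ 0 → toℕ w ≡ 1 → FoldedEdge n v w

FoldedAdj : (n : ℕ) → Rel (Fin n) 0ℓ
FoldedAdj n = SymClosure (FoldedEdge n)

{-# OPTIONS --safe #-}
-- F is a caterpillar: the odd vertices 1, 3, 5, … form a path, and every even
-- vertex is a leaf attached to it.  The distance to a fixed odd vertex is
-- computed by an explicit function changing by at most one along each edge,
-- which bounds walks from below; a walk ending in a leaf pays one further edge.
-- Walks of the claimed lengths are explicit, and erasing loops turns walks into
-- paths, so that distances may be computed with walks.
module Submission where

open import Defs
open import Data.Empty using (⊥-elim)
open import Data.Fin.Base using (Fin; toℕ; fromℕ<)
import Data.Fin.Properties as Fin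
open import Data.List.Membership.Propositional using (_∈_)
import Data.List.Membership.DecPropositional as DecMembership
open import Data.List.Relation.Unary.All using ([])
open import Data.List.Relation.Unary.All.Properties using (¬Any⇒All¬)
open import Data.List.Relation.Unary.AllPairs using ([]; _∷_)
open import Data.List.Relation.Unary.Any using (here; there)
open import Data.List.Relation.Unary.Unique.Propositional using (Unique)
open import Data.Nat.Base
  using (ℕ; zero; suc; _+_; _*_; _∸_; _/_; _%_; _≤_; _<_; z≤n; s≤s; s≤s⁻¹; ∣_-_∣)
open import Data.Nat.DivMod using (m*n/n≡m)
open import Data.Nat.Divisibility using (_∣_; _∤_; divides; n∣m*n)
open import Data.Nat.Primality using (Prime)
open import Data.Nat.Properties
open import Data.Product.Base using (_×_; _,_; ∃-syntax)
open import Data.Sum.Base using (_⊎_; inj₁; inj₂)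
open import Level using (0ℓ)
open import Relation.Binary.Core using (Rel)
open import Relation.Binary.Construct.Closure.ReflexiveTransitive using (Star; ε; _◅_)
open import Relation.Binary.Construct.Closure.Symmetric
  using (SymClosure; fwd; bwd; gmap; symmetric)
open import Relation.Binary.Definitions using (DecidableEquality; Symmetric)
open import Relation.Binary.PropositionalEquality
  using (_≡_; _≢_; refl; sym; trans; cong; subst)
open import Relation.Nullary using (yes; no)

-- Walks, loop erasure and graph distance.

Walk : {V : Set} → Rel V 0ℓ → V → V → ℕ → Set
Walk _~_ v w d = ∃[ p ] edgeCount {_~_ = _~_} {v} {w} p ≡ d

module _ {V : Set} {_~_ : Rel V 0ℓ} where

  _◅ʷ_ : ∀ {u v w d} → u ~ v → Walk _~_ v w d → Walk _~_ u w (suc d)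
  e ◅ʷ (p , eq) = (e ◅ p) , cong suc eq

  _▻ʷ_ : ∀ {u v w d} → Walk _~_ u v d → v ~ w → Walk _~_ u w (suc d)
  (ε , refl)     ▻ʷ e = (e ◅ ε) , refl
  (f ◅ p , refl) ▻ʷ e = f ◅ʷ ((p , refl) ▻ʷ e)

  reverseWalk : Symmetric _~_ → ∀ {v w d} → Walk _~_ v w d → Walk _~_ w v d
  reverseWalk s (ε , refl)     = ε , refl
  reverseWalk s (e ◅ p , refl) = reverseWalk s (p , refl) ▻ʷ s e

  suffixFrom : ∀ {u v w} (p : Star _~_ v w) → Unique (vertices p) → u ∈ vertices p →
               ∃[ q ] length {_~_ = _~_} {u} {w} q ≤ edgeCount p
  suffixFrom ε       uq       (here refl) = (ε , uq) , z≤n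
  suffixFrom (e ◅ p) uq       (here refl) = (e ◅ p , uq) , ≤-refl
  suffixFrom (e ◅ p) (_ ∷ uq) (there u∈p) with suffixFrom p uq u∈p
  ... | q , q≤p = q , m≤n⇒m≤1+n q≤p

  module _ (_≟ⱽ_ : DecidableEquality V) where

    open DecMembership _≟ⱽ_ using (_∈?_)

    -- The tail is made into a path first. If `v` recurs on that path, everything before the
    -- recurrence is cut off by `suffixFrom`; otherwise `v` can be put in front.
    loopErase : ∀ {v w} (p : Star _~_ v w) →
                ∃[ q ] length {_~_ = _~_} {v} {w} q ≤ edgeCount p
    loopErase ε = (ε , [] ∷ []) , z≤n
    loopErase {v} (e ◅ p) with loopErase p
    ... | (q , uq) , q≤p with v ∈? vertices q
    ...   | no v∉q = (e ◅ q , ¬Any⇒All¬ _ v∉q ∷ uq) , s≤s q≤p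
    ...   | yes v∈q with suffixFrom q uq v∈q
    ...     | r , r≤q = r , m≤n⇒m≤1+n (≤-trans r≤q q≤p)

    -- Loop erasure gives a path no longer than the walk, and the lower bound forbids a shorter one,
    -- so the erased path has length exactly `d`.
    fromWalks : ∀ {v w d} → Walk _~_ v w d →
                (∀ (p : Star _~_ v w) → d ≤ edgeCount p) → IsDistance _~_ v w d
    fromWalks (p , refl) lower with loopErase p
    ... | (q , uq) , q≤p = record
      { attained = (q , uq) , ≤-antisym q≤p (lower q)
      ; minimal  = λ (r , _) → lower r
      }

    walk-minimal : ∀ {v w d} → IsDistance _~_ v w d →
                   (p : Star _~_ v w) → d ≤ edgeCount p
    walk-minimal dist p with loopErase p
    ... | q , q≤p = ≤-trans (IsDistance.minimal dist q) q≤p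

    -- Reversal happens at the level of walks, where no distinctness of vertices has to be carried
    -- along.
    distance-sym : Symmetric _~_ → ∀ {v w d} →
                   IsDistance _~_ v w d → IsDistance _~_ w v d
    distance-sym s {d = d} dist with IsDistance.attained dist
    ... | (p , _) , len = fromWalks (reverseWalk s (p , len)) lower
      where
      lower : ∀ q → d ≤ edgeCount q
      lower q with reverseWalk s (q , refl)
      ... | r , eq = ≤-trans (walk-minimal dist r) (≤-reflexive eq)

  -- Each edge lowers `f` by at most one. When `f w` is 0, `f v` bounds every walk to `w` from
  -- below.
  lipschitz⇒≤ : (f : V → ℕ) → (∀ {x y} → x ~ y → f x ≤ suc (f y)) →
                ∀ {v w} (p : Star _~_ v w) → f v ≤ edgeCount p + f w
  lipschitz⇒≤ f lip ε       = ≤-refl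
  lipschitz⇒≤ f lip (e ◅ p) = ≤-trans (lip e) (s≤s (lipschitz⇒≤ f lip p))

-- Parity and absolute differences.

even≢odd′ : ∀ m n → m * 2 ≢ suc (n * 2)
even≢odd′ (suc m) (suc n) eq = even≢odd′ m n (suc-injective (suc-injective eq))

parity : ∀ n → (∃[ k ] n ≡ k * 2) ⊎ (∃[ k ] n ≡ 1 + k * 2)
parity zero = inj₁ (0 , refl)
parity (suc n) with parity n
... | inj₁ (k , refl) = inj₂ (k , refl)
... | inj₂ (k , refl) = inj₁ (suc k , refl)

odd⇒1+k*2 : ∀ {n} → 2 ∤ n → ∃[ k ] n ≡ 1 + k * 2
odd⇒1+k*2 {n} 2∤n with parity n
... | inj₁ (k , refl) = ⊥-elim (2∤n (n∣m*n k))
... | inj₂ r          = r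

-- The offset 2 makes `k` the index of the odd vertex `1 + k * 2` on which this leaf hangs.
even⇒2+k*2 : ∀ {n} → 2 ∣ n → n ≢ 0 → ∃[ k ] n ≡ 2 + k * 2
even⇒2+k*2 (divides zero    eq) n≢0 = ⊥-elim (n≢0 eq)
even⇒2+k*2 (divides (suc k) eq) _   = k , eq

odd≥3⇒3+k*2 : ∀ {n} → 2 ∤ n → 3 ≤ n → ∃[ k ] n ≡ 3 + k * 2
odd≥3⇒3+k*2 2∤n 3≤n with odd⇒1+k*2 2∤n
... | zero  , refl with s≤s () ← 3≤n
... | suc k , refl = k , refl

∣m*2-n*2∣/2 : ∀ m n → ∣ m * 2 - n * 2 ∣ / 2 ≡ ∣ m - n ∣
∣m*2-n*2∣/2 m n =
  trans (cong (_/ 2) (sym (*-distribʳ-∣-∣ 2 m n))) (m*n/n≡m ∣ m - n ∣ 2)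

∣m-n∣≤1+∣1+m-n∣ : ∀ m n → ∣ m - n ∣ ≤ suc ∣ suc m - n ∣
∣m-n∣≤1+∣1+m-n∣ zero    zero    = z≤n
∣m-n∣≤1+∣1+m-n∣ zero    (suc n) = ≤-refl
∣m-n∣≤1+∣1+m-n∣ (suc m) zero    = m≤n⇒m≤1+n (n≤1+n _)
∣m-n∣≤1+∣1+m-n∣ (suc m) (suc n) = ∣m-n∣≤1+∣1+m-n∣ m n

∣1+m-n∣≤1+∣m-n∣ : ∀ m n → ∣ suc m - n ∣ ≤ suc ∣ m - n ∣
∣1+m-n∣≤1+∣m-n∣ zero    zero    = ≤-refl
∣1+m-n∣≤1+∣m-n∣ zero    (suc n) = m≤n⇒m≤1+n (n≤1+n n)
∣1+m-n∣≤1+∣m-n∣ (suc m) zero    = ≤-refl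
∣1+m-n∣≤1+∣m-n∣ (suc m) (suc n) = ∣1+m-n∣≤1+∣m-n∣ m n

-- The infinite caterpillar on the natural numbers.

data Edge : Rel ℕ 0ℓ where
  spine : ∀ s → Edge (1 + s * 2) (3 + s * 2)
  leaf  : ∀ s → Edge (1 + s * 2) (2 + s * 2)
  base  : Edge 0 1

2*k+n≡n+k*2 : ∀ k n → 2 * k + n ≡ n + k * 2
2*k+n≡n+k*2 k n = trans (+-comm (2 * k) n) (cong (n +_) (*-comm 2 k))

toEdge : ∀ {n} {v w : Fin n} → FoldedEdge n v w → Edge (toℕ v) (toℕ w)
toEdge (spine (suc k) _ _ v≡ w≡)
  rewrite trans v≡ (cong (_∸ 1) (*-comm 2 (suc k))) | trans w≡ (2*k+n≡n+k*2 (suc k) 1)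
  = spine k
toEdge (leaf k _ v≡ w≡)
  rewrite trans v≡ (2*k+n≡n+k*2 k 1) | trans w≡ (2*k+n≡n+k*2 k 2) = leaf k
toEdge (base v≡ w≡) rewrite v≡ | w≡ = base

-- The index `s` of the odd vertex `1 + s * 2` that is `n` itself or carries the leaf `n`. Vertex 1
-- carries two leaves, 0 and 2, so 0, 1 and 2 share the foot 0.
foot : ℕ → ℕ
foot (suc (suc (suc n))) = suc (foot (suc n))
foot _                   = 0

height : ℕ → ℕ
height 0             = 1
height 1             = 0
height (suc (suc n)) = height n

foot-odd : ∀ s → foot (1 + s * 2) ≡ s
foot-odd zero    = refl
foot-odd (suc s) = cong suc (foot-odd s)

height-odd : ∀ s → height (1 + s * 2) ≡ 0
height-odd zero    = refl
height-odd (suc s) = height-odd s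

foot-even : ∀ s → foot (2 + s * 2) ≡ s
foot-even zero    = refl
foot-even (suc s) = cong suc (foot-even s)

height-even : ∀ s → height (2 + s * 2) ≡ 1
height-even zero    = refl
height-even (suc s) = height-even s

-- The distance from n to the odd vertex 1 + t * 2 (not to the vertex t).
distToSpine : ℕ → ℕ → ℕ
distToSpine t n = ∣ foot n - t ∣ + height n

distToSpine-odd : ∀ t s → distToSpine t (1 + s * 2) ≡ ∣ s - t ∣
distToSpine-odd t s rewrite foot-odd s | height-odd s = +-identityʳ _

distToSpine-even : ∀ t s → distToSpine t (2 + s * 2) ≡ suc ∣ s - t ∣
distToSpine-even t s rewrite foot-even s | height-even s = +-comm _ 1

-- A spine edge moves the foot by one and keeps the height 0; the edges to leaves, `base` included,
-- keep the foot and change only the height.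
distToSpine-lipschitz : ∀ t {x y} → SymClosure Edge x y →
                        distToSpine t x ≤ suc (distToSpine t y)
distToSpine-lipschitz t (fwd (spine s))
  rewrite distToSpine-odd t s | distToSpine-odd t (suc s) = ∣m-n∣≤1+∣1+m-n∣ s t
distToSpine-lipschitz t (fwd (leaf s))
  rewrite distToSpine-odd t s | distToSpine-even t s = m≤n⇒m≤1+n (n≤1+n _)
distToSpine-lipschitz t (fwd base)
  rewrite +-comm t 1 | +-comm t 0 = ≤-refl
distToSpine-lipschitz t (bwd (spine s))
  rewrite distToSpine-odd t s | distToSpine-odd t (suc s) = ∣1+m-n∣≤1+∣m-n∣ s t
distToSpine-lipschitz t (bwd (leaf s))
  rewrite distToSpine-odd t s | distToSpine-even t s = ≤-refl
distToSpine-lipschitz t (bwd base)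
  rewrite +-comm t 1 | +-comm t 0 = m≤n⇒m≤1+n (n≤1+n t)

-- Parity excludes every edge at `2 + t * 2` except the one to its own spine vertex.
leaf-neighbour : ∀ t {x y} → SymClosure Edge x y → y ≡ 2 + t * 2 → x ≡ 1 + t * 2
leaf-neighbour t (fwd (spine s)) eq =
  ⊥-elim (even≢odd′ t s (sym (suc-injective (suc-injective eq))))
leaf-neighbour t (fwd (leaf s))  eq = cong (_∸ 1) eq
leaf-neighbour t (bwd (spine s)) eq = ⊥-elim (even≢odd′ s t (suc-injective eq))
leaf-neighbour t (bwd (leaf s))  eq = ⊥-elim (even≢odd′ s t (suc-injective eq))

-- Lower bounds for walks in the folded component.

module _ {n : ℕ} where

  adj-sym : Symmetric (FoldedAdj n)
  adj-sym = symmetric (FoldedEdge n)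

  toℕ-adj : {v w : Fin n} → FoldedAdj n v w → SymClosure Edge (toℕ v) (toℕ w)
  toℕ-adj = gmap toℕ toEdge

  -- `distToSpine t` is 1-Lipschitz along edges and vanishes at `w`.
  distToSpine≤ : ∀ t {v w : Fin n} → toℕ w ≡ 1 + t * 2 →
                 (p : Star (FoldedAdj n) v w) → distToSpine t (toℕ v) ≤ edgeCount p
  distToSpine≤ t {v} {w} w≡ p = subst (distToSpine t (toℕ v) ≤_) eq
    (lipschitz⇒≤ (λ x → distToSpine t (toℕ x))
      (λ e → distToSpine-lipschitz t (toℕ-adj e)) p)
    where
    eq : edgeCount p + distToSpine t (toℕ w) ≡ edgeCount p
    eq rewrite w≡ | distToSpine-odd t t | ∣n-n∣≡0 t = +-identityʳ _

  -- A walk can enter the leaf `w` only from `1 + t * 2`, so it first covers the distance to that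
  -- vertex and then takes one more edge; this makes the inequality strict.
  distToSpine<leaf : ∀ t {v w : Fin n} → toℕ w ≡ 2 + t * 2 → v ≢ w →
                     (p : Star (FoldedAdj n) v w) → distToSpine t (toℕ v) < edgeCount p
  distToSpine<leaf t w≡ v≢w ε = ⊥-elim (v≢w refl)
  distToSpine<leaf t {v} {w} w≡ v≢w (_◅_ {j = u} e p) with u Fin.≟ w
  ... | no u≢w   = s≤s (≤-trans (distToSpine-lipschitz t (toℕ-adj e))
                                (distToSpine<leaf t w≡ u≢w p))
  -- On arrival at `w` the preceding vertex is `1 + t * 2`, at distance 0 from itself; the edge `e`
  -- alone suffices, whatever `p` does afterwards.
  ... | yes refl rewrite leaf-neighbour t (toℕ-adj e) w≡
                       | distToSpine-odd t t | ∣n-n∣≡0 t = s≤s z≤n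

-- Explicit walks and distances on `3 + h * 2` vertices.

module _ (h : ℕ) where

  private
    n = 3 + h * 2
    Adj = FoldedAdj n

    ≤-half : ∀ {k} → k ≤ h → k ≤ (n ∸ 3) / 2
    ≤-half k≤h = ≤-trans k≤h (≤-reflexive (sym (m*n/n≡m h 2)))

  -- Spine edges are counted from 1, hence the index `suc s`. Its upper bound comes from the label
  -- of `w` being below `n`.
  spineEdge : ∀ s {v w : Fin n} → toℕ v ≡ 1 + s * 2 → toℕ w ≡ 3 + s * 2 → Adj v w
  spineEdge s {v} {w} v≡ w≡ = fwd (spine (suc s) (s≤s z≤n) (≤-half s<h)
    (trans v≡ (cong (_∸ 1) (*-comm (suc s) 2)))
    (trans w≡ (sym (2*k+n≡n+k*2 (suc s) 1))))
    where
    s<h : s < h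
    s<h = *-cancelʳ-< 2 s h
      (s≤s⁻¹ (s≤s⁻¹ (s≤s⁻¹ (subst (_< n) w≡ (Fin.toℕ<n w)))))

  leafEdge : ∀ s {v w : Fin n} → toℕ v ≡ 1 + s * 2 → toℕ w ≡ 2 + s * 2 → Adj v w
  leafEdge s {v} {w} v≡ w≡ = fwd (leaf s (≤-half s≤h)
    (trans v≡ (sym (2*k+n≡n+k*2 s 1)))
    (trans w≡ (sym (2*k+n≡n+k*2 s 2))))
    where
    s≤h : s ≤ h
    s≤h = *-cancelʳ-≤ s h 2
      (s≤s⁻¹ (s≤s⁻¹ (s≤s⁻¹ (subst (_< n) w≡ (Fin.toℕ<n w)))))

  spineWalk-up : ∀ k s {v w : Fin n} → toℕ v ≡ 1 + s * 2 → toℕ w ≡ 1 + (k + s) * 2 →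
                 Walk Adj v w k
  spineWalk-up zero    s v≡ w≡ with refl ← Fin.toℕ-injective (trans v≡ (sym w≡)) =
    ε , refl
  spineWalk-up (suc k) s {v} {w} v≡ w≡ =
    spineEdge s v≡ (Fin.toℕ-fromℕ< u<n) ◅ʷ
    spineWalk-up k (suc s) (Fin.toℕ-fromℕ< u<n)
      (trans w≡ (cong (λ j → 1 + j * 2) (sym (+-suc k s))))
    where
    -- The next spine vertex exists because it does not lie beyond `w`.
    u<n : 3 + s * 2 < n
    u<n = ≤-<-trans
      (subst (3 + s * 2 ≤_) (sym w≡) (s≤s (*-monoˡ-≤ 2 (s≤s (m≤n+m s k)))))
      (Fin.toℕ<n w)

  spineWalk : ∀ s t {v w : Fin n} → toℕ v ≡ 1 + s * 2 → toℕ w ≡ 1 + t * 2 →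
              Walk Adj v w ∣ s - t ∣
  spineWalk s t v≡ w≡ with ≤-total s t
  ... | inj₁ s≤t rewrite m≤n⇒∣m-n∣≡n∸m s≤t =
    spineWalk-up (t ∸ s) s v≡
      (trans w≡ (cong (λ j → 1 + j * 2) (sym (m∸n+n≡m s≤t))))
  ... | inj₂ t≤s rewrite m≤n⇒∣n-m∣≡n∸m t≤s = reverseWalk adj-sym
    (spineWalk-up (s ∸ t) t w≡
      (trans v≡ (cong (λ j → 1 + j * 2) (sym (m∸n+n≡m t≤s)))))

  parent : ∀ s {v : Fin n} → toℕ v ≡ 2 + s * 2 → ∃[ u ] toℕ {n} u ≡ 1 + s * 2
  parent s {v} v≡ = fromℕ< u<n , Fin.toℕ-fromℕ< u<n
    where
    u<n : 1 + s * 2 < n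
    u<n = <⇒≤ (subst (_< n) v≡ (Fin.toℕ<n v))

  distance-refl : ∀ v → IsDistance Adj v v (∣ toℕ v - toℕ v ∣ / 2)
  distance-refl v rewrite ∣n-n∣≡0 (toℕ v) =
    fromWalks Fin._≟_ (ε , refl) (λ _ → z≤n)

  distance-odd-odd : ∀ {v w} → 2 ∤ toℕ v → 2 ∤ toℕ w →
                     IsDistance Adj v w (∣ toℕ v - toℕ w ∣ / 2)
  distance-odd-odd {v} {w} v-odd w-odd
    with s , v≡ ← odd⇒1+k*2 v-odd | t , w≡ ← odd⇒1+k*2 w-odd
    = subst (IsDistance Adj v w) (sym len)
        (fromWalks Fin._≟_ (spineWalk s t v≡ w≡) lower)
    where
    len : ∣ toℕ v - toℕ w ∣ / 2 ≡ ∣ s - t ∣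
    len rewrite v≡ | w≡ = ∣m*2-n*2∣/2 s t
    lower : ∀ p → ∣ s - t ∣ ≤ edgeCount p
    lower p = subst (_≤ edgeCount p)
      (trans (cong (distToSpine t) v≡) (distToSpine-odd t s)) (distToSpine≤ t w≡ p)

  -- For `w` equal to `1 + t * 2`, `toℕ w + 1` is the label of the even leaf on `w`, so the halved
  -- difference compares two leaves and equals the distance between their feet. The added 1 is the
  -- edge from `v` to its foot.
  distance-even-odd : ∀ {v w} → toℕ v ≢ 0 → 2 ∣ toℕ v → 2 ∤ toℕ w →
                      IsDistance Adj v w (∣ toℕ v - (toℕ w + 1) ∣ / 2 + 1)
  distance-even-odd {v} {w} v≢0 v-even w-odd
    with s , v≡ ← even⇒2+k*2 v-even v≢0 | t , w≡ ← odd⇒1+k*2 w-odd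
    with u , u≡ ← parent s v≡
    = subst (IsDistance Adj v w) (sym len)
        (fromWalks Fin._≟_ (adj-sym (leafEdge s u≡ v≡) ◅ʷ spineWalk s t u≡ w≡) lower)
    where
    len : ∣ toℕ v - (toℕ w + 1) ∣ / 2 + 1 ≡ suc ∣ s - t ∣
    len rewrite v≡ | w≡ | +-comm (t * 2) 1 =
      trans (+-comm _ 1) (cong suc (∣m*2-n*2∣/2 s t))
    lower : ∀ p → suc ∣ s - t ∣ ≤ edgeCount p
    lower p = subst (_≤ edgeCount p)
      (trans (cong (distToSpine t) v≡) (distToSpine-even t s)) (distToSpine≤ t w≡ p)

  distance-even-even : ∀ {v w} → toℕ v ≢ 0 → toℕ w ≢ 0 → 2 ∣ toℕ v → 2 ∣ toℕ w → v ≢ w →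
                       IsDistance Adj v w (∣ toℕ v - toℕ w ∣ / 2 + 2)
  distance-even-even {v} {w} v≢0 w≢0 v-even w-even v≢w
    with s , v≡ ← even⇒2+k*2 v-even v≢0 | t , w≡ ← even⇒2+k*2 w-even w≢0
    with u , u≡ ← parent s v≡ | x , x≡ ← parent t w≡
    = subst (IsDistance Adj v w) (sym len)
        (fromWalks Fin._≟_
          (adj-sym (leafEdge s u≡ v≡) ◅ʷ (spineWalk s t u≡ x≡ ▻ʷ leafEdge t x≡ w≡)) lower)
    where
    len : ∣ toℕ v - toℕ w ∣ / 2 + 2 ≡ 2 + ∣ s - t ∣
    len rewrite v≡ | w≡ = trans (+-comm _ 2) (cong (2 +_) (∣m*2-n*2∣/2 s t))
    lower : ∀ p → 2 + ∣ s - t ∣ ≤ edgeCount p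
    -- `distToSpine` already counts the edge leaving `v`; the strict inequality supplies the edge
    -- entering `w`.
    lower p = subst (_< edgeCount p)
      (trans (cong (distToSpine t) v≡) (distToSpine-even t s))
      (distToSpine<leaf t w≡ v≢w p)

proposition23 : (p : ℕ) → Prime p → (p % 120 ≡ 71 ⊎ p % 120 ≡ 119) →
    (𝔭 : Ideal (𝓞 p)) → IsPrimeAbove 2 p 𝔭 →
    (ord : ℕ) → HasClassOrder 𝔭 ord → 2 ∤ ord → 3 ≤ ord →
    (v w : Fin ord) → toℕ v ≢ 0 → toℕ w ≢ 0 →
    ((2 ∤ toℕ v × 2 ∤ toℕ w) ⊎ v ≡ w →
    IsDistance (FoldedAdj ord) v w (∣ toℕ v - toℕ w ∣ / 2))
    × (2 ∣ toℕ v → 2 ∤ toℕ w →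
    IsDistance (FoldedAdj ord) v w (∣ toℕ v - (toℕ w + 1) ∣ / 2 + 1))
    × (2 ∣ toℕ v → 2 ∣ toℕ w → v ≢ w →
    IsDistance (FoldedAdj ord) v w (∣ toℕ v - toℕ w ∣ / 2 + 2))
    × (∀ d → IsDistance (FoldedAdj ord) v w d → IsDistance (FoldedAdj ord) w v d)
proposition23 _ _ _ _ _ _ _ ord-odd 3≤ord v w v≢0 w≢0
  -- In this form the bound `(ord ∸ 3) / 2` on edge indices is exactly `h`.
  with h , refl ← odd≥3⇒3+k*2 ord-odd 3≤ord
  = (λ { (inj₁ (v-odd , w-odd)) → distance-odd-odd h v-odd w-odd
       ; (inj₂ refl)            → distance-refl h v })
  , distance-even-odd h v≢0
  , distance-even-even h v≢0 w≢0
  , (λ _ → distance-sym Fin._≟_ adj-sym)
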